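{- Let $m,n$ be positive integers. If $\min\{m,n\}=1$, then $w_{c}(K_{m,n})=W_{c}(K_{m,n})=m+n-1$. If $\min\{m,n\}\geq 2$, then $\left[\max\{m,n\},m+n\right]\subseteq F\left(K_{m,n}\right)$.
   Context: $K_{m,n}$ is the complete bipartite graph with parts of sizes $m$ and $n$. For a finite simple graph $G$ and a positive integer $t$, an interval cyclic $t$-coloring of $G$ is a proper edge-coloring of $G$ with colors $1,\ldots,t$ such that all $t$ colors are used and, for each vertex $v$, the edges incident to $v$ are colored by $d_{G}(v)$ consecutive colors modulo $t$ (i.e. consecutive in the cyclic order $1,2,\ldots,t,1$), where $d_G(v)$ is the degree of $v$. The feasible set $F(G)$ is the set of all $t$ such that $G$ has an interval cyclic $t$-coloring; when $F(G)\neq\emptyset$, $w_{c}(G)$ and $W_{c}(G)$ are the least and the greatest elements of $F(G)$. $[a,b]$ denotes the set of integers $\{a,\ldots,b\}$. -}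

module Defs where

open import Data.Fin using (Fin; toℕ)
open import Data.Fin.Properties using (+↔⊎)
open import Data.List using (List; length; filter; map; allFin)
open import Data.Nat using (ℕ; _+_; _≤_; _<_; _%_; NonZero)
open import Data.Product using (∃; ∃-syntax; Σ-syntax; _×_)
open import Data.Sum using (_⊎_; inj₁; inj₂)
open import Function using (_↔_; _⇔_; Inverse)
open import Level using (0ℓ)
open import Relation.Binary using (Rel; Symmetric; Irreflexive; Decidable)
open import Relation.Binary.PropositionalEquality using (_≡_; _≢_)
open import Relation.Nullary using (yes; no)
open import Relation.Unary using (Pred; _∈_)

record FiniteSimpleGraph : Set₁ where
  field
    Vertex      : Set
    order       : ℕ
    enumeration : Fin order ↔ Vertex
    _~_         : Rel Vertex 0ℓ
    _~?_        : Decidable _~_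
    ~-sym       : Symmetric _~_
    ~-irrefl    : Irreflexive _≡_ _~_

  vertices : List Vertex
  vertices = map (Inverse.to enumeration) (allFin order)

  degree : Vertex → ℕ
  degree v = length (filter (v ~?_) vertices)

-- The colours 1, …, t are represented by Fin t, the element with value i
-- standing for the colour i + 1.

-- The d cyclically consecutive colours s, s + 1, …, s + d - 1 modulo t.
CyclicInterval : (t : ℕ) .{{_ : NonZero t}} → Fin t → ℕ → Pred (Fin t) 0ℓ
CyclicInterval t s d k = ∃[ i ] i < d × toℕ k ≡ (toℕ s + i) % t

module _ (G : FiniteSimpleGraph) where
  open FiniteSimpleGraph G

  -- An undirected edge is presented by adjacency proofs in both directions.
  -- Applying `unoriented` twice shows that the colour also does not depend
  -- on the choice of the adjacency proof.
  record EdgeColoring (t : ℕ) : Set where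
    field
      color      : ∀ {u v} → u ~ v → Fin t
      unoriented : ∀ {u v} (e : u ~ v) (e′ : v ~ u) → color e ≡ color e′

  module _ {t : ℕ} (c : EdgeColoring t) where
    open EdgeColoring c

    Proper : Set
    Proper = ∀ {u v w} (e : u ~ v) (e′ : u ~ w) → v ≢ w → color e ≢ color e′

    UsesAllColors : Set
    UsesAllColors = ∀ k → ∃[ u ] ∃[ v ] Σ[ e ∈ u ~ v ] color e ≡ k

    Spectrum : Vertex → Pred (Fin t) 0ℓ
    Spectrum v k = ∃[ u ] Σ[ e ∈ v ~ u ] color e ≡ k

  record IsIntervalCyclic (t : ℕ) .{{_ : NonZero t}} (c : EdgeColoring t) : Set where
    field
      proper        : Proper c
      usesAllColors : UsesAllColors c
      consecutive   : ∀ v → ∃[ s ] (∀ k →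
                        k ∈ Spectrum c v ⇔ k ∈ CyclicInterval t s (degree v))

  F : Pred ℕ 0ℓ
  F t = Σ[ t≢0 ∈ NonZero t ] ∃ (IsIntervalCyclic t {{t≢0}})

IsLeast : Pred ℕ 0ℓ → ℕ → Set
IsLeast P a = a ∈ P × (∀ {b} → b ∈ P → a ≤ b)

IsGreatest : Pred ℕ 0ℓ → ℕ → Set
IsGreatest P a = a ∈ P × (∀ {b} → b ∈ P → b ≤ a)

-- The partial functions w_c and W_c, given by their graphs: `wc[ G ]≡ a`
-- says that F G is nonempty and that its least element is a.
wc[_]≡_ : FiniteSimpleGraph → ℕ → Set
wc[ G ]≡ a = IsLeast (F G) a

Wc[_]≡_ : FiniteSimpleGraph → ℕ → Set
Wc[ G ]≡ a = IsGreatest (F G) a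

[_,_] : ℕ → ℕ → Pred ℕ 0ℓ
[ a , b ] t = a ≤ t × t ≤ b

data Across {m n : ℕ} : Rel (Fin m ⊎ Fin n) 0ℓ where
  left-right : ∀ {i j} → Across (inj₁ i) (inj₂ j)
  right-left : ∀ {i j} → Across (inj₂ j) (inj₁ i)

K : ℕ → ℕ → FiniteSimpleGraph
K m n = record
  { Vertex      = Fin m ⊎ Fin n
  ; order       = m + n
  ; enumeration = +↔⊎
  ; _~_         = Across
  ; _~?_        = across?
  ; ~-sym       = λ { left-right → right-left ; right-left → left-right }
  ; ~-irrefl    = λ { {inj₁ _} {inj₁ _} _ () ; {inj₂ _} {inj₂ _} _ ()
                    ; {inj₁ _} {inj₂ _} () _ ; {inj₂ _} {inj₁ _} () _ }
  }
  where
  across? : Decidable (Across {m} {n})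
  across? (inj₁ _) (inj₁ _) = no λ ()
  across? (inj₁ _) (inj₂ _) = yes left-right
  across? (inj₂ _) (inj₁ _) = yes right-left
  across? (inj₂ _) (inj₂ _) = no λ ()

{-# OPTIONS --safe #-}
module Submission where

-- View a colouring of K m n as an m × n table of colours, rows and columns
-- being the stars at the vertices. If every row and every column is, up to a
-- permutation of its cells, a run s, s + 1, s + 2, … modulo t, and if
-- t ≥ max(m, n), then the table is interval cyclic as soon as every colour
-- occurs (`table⇒F`). Two tables suffice, with cells indexed from 0.
--
-- * For max(m, n) ≤ t < m + n, put i + j modulo t in cell (i , j). All rows
--   and columns are runs, and the values i + j exhaust 0, …, m + n - 2.
--
-- * For t = m + n and m, n ≥ 2, the only colour that i + j misses is
--   m + n - 1 ≡ -1. Put it in the last cell of column 0, replacing m - 1.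
--   Column 0 turns from 0, …, m - 1 into -1, 0, …, m - 2, and the last row
--   from m - 1, …, m + n - 2 into m, …, m + n - 1: both are still runs. The
--   replaced colour m - 1 survives in another cell because m, n ≥ 2.
--
-- Conversely, a colour count bounds every t ∈ F (K m n): properness at one
-- vertex of each part gives n ≤ t and m ≤ t, and each of the t colours lies
-- on one of the m * n edges. For min(m, n) = 1 this forces t = m + n - 1,
-- which the first table attains.

open import Defs
open import Data.Fin
  using (Fin; zero; suc; toℕ; fromℕ; fromℕ<; inject₁; combine; splitAt; _↑ˡ_; _↑ʳ_)
open import Data.Fin.Permutation as Perm
  using (Permutation′; permutation; _⟨$⟩ʳ_; _⟨$⟩ˡ_)
open import Data.Fin.Properties
  using (toℕ-injective; toℕ<n; toℕ-fromℕ; toℕ-fromℕ<; toℕ-inject₁;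
         splitAt-↑ˡ; splitAt-↑ʳ; combine-injective; injective⇒≤; _≟_)
open import Data.Fin.Relation.Unary.Top
  using (view; view-fromℕ; view-inject₁; ‵fromℕ; ‵inject₁)
open import Data.List using (List; _∷_; length; filter; tabulate; _++_)
open import Data.List.Properties
  using (filter-++; filter-all; filter-none; ++-identityʳ; length-tabulate;
         map-tabulate; tabulate-cong)
open import Data.List.Relation.Unary.All.Properties using (tabulate⁺)
open import Data.Nat
  using (ℕ; zero; suc; NonZero; _+_; _*_; _∸_; _≤_; _<_; _⊓_; _⊔_; s≤s; _%_; _<?_)
open import Data.Nat.DivMod
  using (_mod_; m%n<n; m<n⇒m%n≡m; m%n%n≡m%n; [m+n]%n≡m%n; %-distribˡ-+)
open import Data.Nat.Properties
  using (+-comm; +-assoc; +-suc; +-identityʳ; *-identityˡ; *-identityʳ;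
         ≤-trans; ≤-refl; ≤-reflexive; ≤-antisym; m≤m+n; m≤n+m; m≤m⊔n; m≤n⊔m;
         <⇒≤; ≮⇒≥; m∸n+n≡m; m+[n∸m]≡n; ⊓-sel; m≤n⇒m<n∨m≡n;
         +-cancelʳ-<; m⊓n≤m; m⊓n≤n; ≤-pred)
open import Data.Product using (∃-syntax; _×_; _,_; proj₁; proj₂)
open import Data.Sum using (_⊎_; inj₁; inj₂)
open import Function using (_∘_; _⇔_; mk⇔; id; Injective; module Equivalence)
open import Relation.Binary.PropositionalEquality
  using (_≡_; refl; sym; trans; cong; cong₂; subst; module ≡-Reasoning)
open import Relation.Nullary using (yes; no; contradiction)
open import Relation.Unary using (_∈_; _⊆_)

-- Arithmetic modulo t

toℕ-mod : ∀ a t .{{_ : NonZero t}} → toℕ (a mod t) ≡ a % t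
toℕ-mod a t = toℕ-fromℕ< (m%n<n a t)

%-absorbˡ-+ : ∀ a b t .{{_ : NonZero t}} → (a % t + b) % t ≡ (a + b) % t
%-absorbˡ-+ a b t = begin
  (a % t + b) % t          ≡⟨ %-distribˡ-+ (a % t) b t ⟩
  (a % t % t + b % t) % t  ≡⟨ cong (λ x → (x + b % t) % t) (m%n%n≡m%n a t) ⟩
  (a % t + b % t) % t      ≡⟨ %-distribˡ-+ a b t ⟨
  (a + b) % t              ∎
  where open ≡-Reasoning

-- Adding t ∸ s undoes the translation by s.
translation-injective : ∀ {t} .{{_ : NonZero t}} {s a b} → s ≤ t → a < t → b < t →
                        (s + a) % t ≡ (s + b) % t → a ≡ b
translation-injective {t} {s} {a} {b} s≤t a<t b<t eq = begin
  a                            ≡⟨ undo a<t ⟨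
  ((s + a) % t + (t ∸ s)) % t  ≡⟨ cong (λ x → (x + (t ∸ s)) % t) eq ⟩
  ((s + b) % t + (t ∸ s)) % t  ≡⟨ undo b<t ⟩
  b                            ∎
  where
  open ≡-Reasoning
  undo : ∀ {x} → x < t → ((s + x) % t + (t ∸ s)) % t ≡ x
  undo {x} x<t = begin
    ((s + x) % t + (t ∸ s)) % t  ≡⟨ %-absorbˡ-+ (s + x) (t ∸ s) t ⟩
    (s + x + (t ∸ s)) % t        ≡⟨ cong (λ y → (y + (t ∸ s)) % t) (+-comm s x) ⟩
    (x + s + (t ∸ s)) % t        ≡⟨ cong (_% t) (+-assoc x s (t ∸ s)) ⟩
    (x + (s + (t ∸ s))) % t      ≡⟨ cong (λ y → (x + y) % t) (m+[n∸m]≡n s≤t) ⟩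
    (x + t) % t                  ≡⟨ [m+n]%n≡m%n x t ⟩
    x % t                        ≡⟨ m<n⇒m%n≡m x<t ⟩
    x                            ∎

-- Runs of cyclically consecutive colours

-- A family of d colours is a run when, after the permutation `order` of its
-- indices, it lists start, start + 1, …, start + d - 1 modulo t. For d ≤ t
-- this says that the family is injective with a cyclic interval as its image.
record Run (t : ℕ) .{{_ : NonZero t}} {d : ℕ} (g : Fin d → Fin t) : Set where
  constructor run
  field
    start : Fin t
    order : Permutation′ d
    lists : ∀ j → toℕ (g j) ≡ (toℕ start + toℕ (order ⟨$⟩ʳ j)) % t

module _ {t : ℕ} .{{_ : NonZero t}} where

  mod-run : ∀ {d} (g : Fin d → ℕ) (s : ℕ) (π : Permutation′ d) →
            (∀ j → g j % t ≡ (s + toℕ (π ⟨$⟩ʳ j)) % t) →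
            Run t (λ j → g j mod t)
  mod-run g s π eq = run (s mod t) π λ j → begin
    toℕ (g j mod t)                            ≡⟨ toℕ-mod (g j) t ⟩
    g j % t                                    ≡⟨ eq j ⟩
    (s + toℕ (π ⟨$⟩ʳ j)) % t                   ≡⟨ %-absorbˡ-+ s _ t ⟨
    (s % t + toℕ (π ⟨$⟩ʳ j)) % t               ≡⟨ cong (λ x → (x + _) % t) (toℕ-mod s t) ⟨
    (toℕ (s mod t) + toℕ (π ⟨$⟩ʳ j)) % t       ∎
    where open ≡-Reasoning

  module _ {d : ℕ} {g : Fin d → Fin t} (r : Run t g) where
    open Run r

    run-injective : d ≤ t → Injective _≡_ _≡_ g
    run-injective d≤t {x} {y} gx≡gy = begin
      x                            ≡⟨ Perm.inverseˡ order ⟨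
      order ⟨$⟩ˡ (order ⟨$⟩ʳ x)    ≡⟨ cong (order ⟨$⟩ˡ_) (toℕ-injective same-offset) ⟩
      order ⟨$⟩ˡ (order ⟨$⟩ʳ y)    ≡⟨ Perm.inverseˡ order ⟩
      y                            ∎
      where
      open ≡-Reasoning
      offset<t : ∀ j → toℕ (order ⟨$⟩ʳ j) < t
      offset<t j = ≤-trans (toℕ<n _) d≤t
      same-offset : toℕ (order ⟨$⟩ʳ x) ≡ toℕ (order ⟨$⟩ʳ y)
      same-offset = translation-injective (<⇒≤ (toℕ<n start)) (offset<t x) (offset<t y)
        (trans (sym (lists x)) (trans (cong toℕ gx≡gy) (lists y)))

    run-image : ∀ k → (∃[ j ] g j ≡ k) ⇔ k ∈ CyclicInterval t start d
    run-image k = mk⇔ to from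
      where
      to : (∃[ j ] g j ≡ k) → k ∈ CyclicInterval t start d
      to (j , refl) = toℕ (order ⟨$⟩ʳ j) , toℕ<n _ , lists j
      from : k ∈ CyclicInterval t start d → ∃[ j ] g j ≡ k
      from (i , i<d , eq) = j , toℕ-injective (begin
        toℕ (g j)                             ≡⟨ lists j ⟩
        (toℕ start + toℕ (order ⟨$⟩ʳ j)) % t
          ≡⟨ cong (λ x → (toℕ start + toℕ x) % t) (Perm.inverseʳ order) ⟩
        (toℕ start + toℕ (fromℕ< i<d)) % t
          ≡⟨ cong (λ x → (toℕ start + x) % t) (toℕ-fromℕ< i<d) ⟩
        (toℕ start + i) % t                   ≡⟨ eq ⟨
        toℕ k                                 ∎)
        where
        open ≡-Reasoning
        j = order ⟨$⟩ˡ fromℕ< i<d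

-- Degrees in the complete bipartite graph

tabulate-+ : ∀ {A : Set} m {n} (f : Fin (m + n) → A) →
             tabulate f ≡ tabulate (f ∘ (_↑ˡ n)) ++ tabulate (f ∘ (m ↑ʳ_))
tabulate-+ zero    f = refl
tabulate-+ (suc m) f = cong (_ ∷_) (tabulate-+ m (f ∘ suc))

module _ (m n : ℕ) where
  open FiniteSimpleGraph (K m n)

  private
    lefts rights : List Vertex
    lefts  = tabulate inj₁
    rights = tabulate inj₂

  vertices-K : vertices ≡ lefts ++ rights
  vertices-K = begin
    vertices              ≡⟨ map-tabulate id (splitAt m) ⟩
    tabulate (splitAt m)  ≡⟨ tabulate-+ m (splitAt m) ⟩
    tabulate (splitAt m ∘ (_↑ˡ n)) ++ tabulate (splitAt m ∘ (m ↑ʳ_))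
      ≡⟨ cong₂ _++_ (tabulate-cong (λ i → splitAt-↑ˡ m i n)) (tabulate-cong (splitAt-↑ʳ m n)) ⟩
    lefts ++ rights       ∎
    where open ≡-Reasoning

  -- The neighbours of v, counted in each part separately.
  degree-K : ∀ v {xs ys} → filter (v ~?_) lefts ≡ xs → filter (v ~?_) rights ≡ ys →
             degree v ≡ length (xs ++ ys)
  degree-K v refl refl = cong length
    (trans (cong (filter (v ~?_)) vertices-K) (filter-++ (v ~?_) lefts rights))

  degree-left : ∀ i → degree (inj₁ i) ≡ n
  degree-left i = trans
    (degree-K (inj₁ i)
      (filter-none (inj₁ i ~?_) {lefts} (tabulate⁺ {f = inj₁} λ _ ()))
      (filter-all (inj₁ i ~?_) {rights} (tabulate⁺ {f = inj₂} λ _ → left-right)))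
    (length-tabulate {n = n} inj₂)

  degree-right : ∀ j → degree (inj₂ j) ≡ m
  degree-right j = trans
    (degree-K (inj₂ j)
      (filter-all (inj₂ j ~?_) {lefts} (tabulate⁺ {f = inj₁} λ _ → right-left))
      (filter-none (inj₂ j ~?_) {rights} (tabulate⁺ {f = inj₂} λ _ ())))
    (trans (cong length (++-identityʳ lefts)) (length-tabulate {n = m} inj₁))

-- Colourings of K m n from tables of colours

-- Cell (i , j) of the table colours the edge between the left vertex i and the
-- right vertex j.
tableColoring : ∀ {m n t} → (Fin m → Fin n → Fin t) → EdgeColoring (K m n) t
tableColoring c = record
  { color      = λ { (left-right {i} {j}) → c i j ; (right-left {i} {j}) → c i j }
  ; unoriented = λ { left-right right-left → refl ; right-left left-right → refl }
  }

table⇒F : ∀ {m n t} {{_ : NonZero t}} (c : Fin m → Fin n → Fin t) →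
          m ≤ t → n ≤ t →
          (∀ i → Run t (c i)) → (∀ j → Run t (λ i → c i j)) →
          (∀ k → ∃[ i ] ∃[ j ] c i j ≡ k) →
          F (K m n) t
table⇒F {m} {n} {t} {{t≢0}} c m≤t n≤t rows columns onto =
  t≢0 , tableColoring c , record
    { proper = λ
        { left-right left-right v≢w eq → v≢w (cong inj₂ (run-injective (rows _) n≤t eq))
        ; right-left right-left v≢w eq → v≢w (cong inj₁ (run-injective (columns _) m≤t eq))
        }
    ; usesAllColors = λ k → let i , j , eq = onto k in inj₁ i , inj₂ j , left-right , eq
    ; consecutive = λ { (inj₁ i) → left i ; (inj₂ j) → right j }
    }
  where
  open FiniteSimpleGraph (K m n) using (degree)

  left : ∀ i → ∃[ s ] (∀ k → k ∈ Spectrum (K m n) (tableColoring c) (inj₁ i) ⇔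
                             k ∈ CyclicInterval t s (degree (inj₁ i)))
  left i rewrite degree-left m n i = Run.start (rows i) , λ k →
    let open Equivalence (run-image (rows i) k) in
    mk⇔ (λ { (_ , left-right {j = j} , eq) → to (j , eq) })
        (λ k∈I → let j , eq = from k∈I in inj₂ j , left-right , eq)

  right : ∀ j → ∃[ s ] (∀ k → k ∈ Spectrum (K m n) (tableColoring c) (inj₂ j) ⇔
                              k ∈ CyclicInterval t s (degree (inj₂ j)))
  right j rewrite degree-right m n j = Run.start (columns j) , λ k →
    let open Equivalence (run-image (columns j) k) in
    mk⇔ (λ { (_ , right-left {i = i} , eq) → to (i , eq) })
        (λ k∈I → let i , eq = from k∈I in inj₁ i , right-left , eq)

-- The table i + j

-- Row 0 and the last column of the table i + j contain every value up to the
-- largest one.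
sum-cover : ∀ m n {k} → k ≤ m + n →
            (∃[ j ] toℕ {suc n} j ≡ k) ⊎ (∃[ i ] toℕ {suc m} i + n ≡ k)
sum-cover m n {k} k≤m+n with k <? suc n
... | yes k<1+n = inj₁ (fromℕ< k<1+n , toℕ-fromℕ< k<1+n)
... | no  k≮1+n = inj₂ (fromℕ< i<1+m , trans (cong (_+ n) (toℕ-fromℕ< i<1+m)) i+n≡k)
  where
  i+n≡k : k ∸ n + n ≡ k
  i+n≡k = m∸n+n≡m (<⇒≤ (≮⇒≥ k≮1+n))
  i<1+m : k ∸ n < suc m
  i<1+m = +-cancelʳ-< n _ _ (s≤s (≤-trans (≤-reflexive i+n≡k) k≤m+n))

mod-colour : ∀ {t} .{{_ : NonZero t}} (k : Fin t) {a} → a ≡ toℕ k → a mod t ≡ k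
mod-colour {t} k refl = toℕ-injective (trans (toℕ-mod (toℕ k) t) (m<n⇒m%n≡m (toℕ<n k)))

-- The parts have sizes m + 1 and n + 1, so t ranges up to one less than the
-- total number of vertices.
sum-table∈F : ∀ m n {t} {{_ : NonZero t}} → suc m ≤ t → suc n ≤ t → t ≤ suc (m + n) →
              F (K (suc m) (suc n)) t
sum-table∈F m n {t} m<t n<t t≤1+m+n = table⇒F (λ i j → (toℕ i + toℕ j) mod t) m<t n<t
  (λ i → mod-run (λ j → toℕ i + toℕ j) (toℕ i) Perm.id λ _ → refl)
  (λ j → mod-run (λ i → toℕ i + toℕ j) (toℕ j) Perm.id λ i → cong (_% t) (+-comm (toℕ i) (toℕ j)))
  onto
  where
  onto : ∀ k → ∃[ i ] ∃[ j ] (toℕ {suc m} i + toℕ {suc n} j) mod t ≡ k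
  onto k with sum-cover m n (≤-pred (≤-trans (toℕ<n k) t≤1+m+n))
  ... | inj₁ (j , eq) = zero , j , mod-colour k eq
  ... | inj₂ (i , eq) = i , fromℕ n , mod-colour k (trans (cong (toℕ i +_) (toℕ-fromℕ n)) eq)

-- The table for m + n colours

-- The cyclic shift i ↦ i + 1, which sends the last index to 0.
next : ∀ {n} → Fin (suc n) → Fin (suc n)
next i with view i
... | ‵fromℕ     = zero
... | ‵inject₁ j = suc j

previous : ∀ {n} → Fin (suc n) → Fin (suc n)
previous {n} zero = fromℕ n
previous (suc j)  = inject₁ j

next-fromℕ : ∀ n → next (fromℕ n) ≡ zero
next-fromℕ n rewrite view-fromℕ n = refl

next-inject₁ : ∀ {n} (j : Fin n) → next (inject₁ j) ≡ suc j
next-inject₁ j rewrite view-inject₁ j = refl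

next-previous : ∀ {n} (i : Fin (suc n)) → next (previous i) ≡ i
next-previous {n} zero = next-fromℕ n
next-previous (suc j)  = next-inject₁ j

previous-next : ∀ {n} (i : Fin (suc n)) → previous (next i) ≡ i
previous-next i with view i
... | ‵fromℕ     = refl
... | ‵inject₁ j = refl

rotation : ∀ {n} → Permutation′ (suc n)
rotation = permutation next previous next-previous previous-next

-- The table i + j modulo m + n + 2 on suc m rows and suc n columns, except
-- that the last cell of column 0 holds m + n + 1. Column 0 is written as the
-- rotated run that starts at m + n + 1 ≡ -1.
twisted : ∀ {m n} → Fin (suc m) → Fin (suc n) → ℕ
twisted {m} {n} i zero    = m + suc n + toℕ (next i)
twisted         i (suc j) = toℕ i + suc (toℕ j)

module _ {m n : ℕ} where

  private
    t = suc m + suc n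

  -- The cells in columns 1, …, n of the last row hold m + 1, …, m + n, and
  -- the cell in column 0 closes the run with m + n + 1. The order is
  -- therefore the inverse rotation.
  twisted-last : ∀ j → twisted {m} {n} (fromℕ m) j ≡ suc m + toℕ (previous j)
  twisted-last zero rewrite next-fromℕ m | toℕ-fromℕ n =
    trans (+-identityʳ (m + suc n)) (+-suc m n)
  twisted-last (suc j) rewrite toℕ-fromℕ m | toℕ-inject₁ j = +-suc m (toℕ j)

  twisted-inner : ∀ i j → twisted {m} {n} (inject₁ i) j % t ≡ (toℕ i + toℕ j) % t
  twisted-inner i zero rewrite next-inject₁ i = begin
    (m + suc n + suc (toℕ i)) % t  ≡⟨ cong (_% t) (+-suc (m + suc n) (toℕ i)) ⟩
    (t + toℕ i) % t                ≡⟨ cong (_% t) (+-comm t (toℕ i)) ⟩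
    (toℕ i + t) % t                ≡⟨ [m+n]%n≡m%n (toℕ i) t ⟩
    toℕ i % t                      ≡⟨ cong (_% t) (+-identityʳ (toℕ i)) ⟨
    (toℕ i + 0) % t                ∎
    where open ≡-Reasoning
  twisted-inner i (suc j) rewrite toℕ-inject₁ i = refl

  twisted-row : ∀ i → Run t (λ j → twisted {m} {n} i j mod t)
  twisted-row i with view i
  ... | ‵fromℕ     = mod-run (twisted (fromℕ m)) (suc m) (Perm.flip rotation) λ j →
    cong (_% t) (twisted-last j)
  ... | ‵inject₁ i = mod-run (twisted (inject₁ i)) (toℕ i) Perm.id (twisted-inner i)

  twisted-column : ∀ j → Run t (λ i → twisted {m} {n} i j mod t)
  twisted-column zero    = mod-run (λ i → twisted i zero) (m + suc n) rotation λ _ → refl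
  twisted-column (suc j) = mod-run (λ i → twisted i (suc j)) (suc (toℕ j)) Perm.id λ i →
    cong (_% t) (+-comm (toℕ i) (suc (toℕ j)))

-- Row 0 and the last column agree modulo m + n + 4 with the table i + j,
-- because row 0 is not the last row and column 0 is not the last column. The
-- remaining colour m + n + 3 is in the last cell of column 0.
twisted-onto : ∀ m n (k : Fin (suc (suc m) + suc (suc n))) →
               ∃[ i ] ∃[ j ] twisted {suc m} {suc n} i j mod (suc (suc m) + suc (suc n)) ≡ k
twisted-onto m n k with m≤n⇒m<n∨m≡n (≤-pred (toℕ<n k))
... | inj₂ k≡m+n+3 = fromℕ (suc m) , zero , mod-colour k (begin
  suc m + suc (suc n) + toℕ (next (fromℕ (suc m)))
    ≡⟨ cong (λ i → suc m + suc (suc n) + toℕ i) (next-fromℕ (suc m)) ⟩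
  suc m + suc (suc n) + 0  ≡⟨ +-identityʳ _ ⟩
  suc m + suc (suc n)      ≡⟨ k≡m+n+3 ⟨
  toℕ k                    ∎)
  where open ≡-Reasoning
... | inj₁ k<m+n+3
  with sum-cover (suc m) (suc n)
         (≤-pred (subst (toℕ k <_) (+-suc (suc m) (suc n)) k<m+n+3))
...   | inj₂ (i , eq) = i , fromℕ (suc n) ,
        mod-colour k (trans (cong (λ x → toℕ i + suc x) (toℕ-fromℕ n)) eq)
...   | inj₁ (j , eq) = zero , j , toℕ-injective (begin
  toℕ (twisted {suc m} {suc n} zero j mod t)  ≡⟨ toℕ-mod (twisted {suc m} {suc n} zero j) t ⟩
  twisted {suc m} {suc n} zero j % t          ≡⟨ twisted-inner {suc m} {suc n} zero j ⟩
  toℕ j % t                                   ≡⟨ cong (_% t) eq ⟩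
  toℕ k % t                                   ≡⟨ m<n⇒m%n≡m (toℕ<n k) ⟩
  toℕ k                                       ∎)
  where
  open ≡-Reasoning
  t = suc (suc m) + suc (suc n)

m+n∈F : ∀ m n → F (K (suc (suc m)) (suc (suc n))) (suc (suc m) + suc (suc n))
m+n∈F m n = table⇒F _ (m≤m+n (suc (suc m)) _) (m≤n+m _ (suc (suc m)))
  twisted-row twisted-column (twisted-onto m n)

-- Bounds on the number of colours

module _ {m n t : ℕ} (t∈F : t ∈ F (K m n)) where

  private
    coloring : EdgeColoring (K m n) t
    coloring = proj₁ (proj₂ t∈F)

    open EdgeColoring coloring

    instance
      t≢0 : NonZero t
      t≢0 = proj₁ t∈F

    proper : Proper (K m n) coloring
    proper = IsIntervalCyclic.proper (proj₂ (proj₂ t∈F))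

    usesAllColors : UsesAllColors (K m n) coloring
    usesAllColors = IsIntervalCyclic.usesAllColors (proj₂ (proj₂ t∈F))

  right-size≤colours : Fin m → n ≤ t
  right-size≤colours i = injective⇒≤ {f = λ j → color (left-right {i = i} {j})} injective
    where
    injective : Injective _≡_ _≡_ (λ j → color (left-right {i = i} {j}))
    injective {x} {y} eq with x ≟ y
    ... | yes x≡y = x≡y
    ... | no  x≢y = contradiction eq (proper left-right left-right λ { refl → x≢y refl })

  left-size≤colours : Fin n → m ≤ t
  left-size≤colours j = injective⇒≤ {f = λ i → color (right-left {i = i} {j})} injective
    where
    injective : Injective _≡_ _≡_ (λ i → color (right-left {i = i} {j}))
    injective {x} {y} eq with x ≟ y
    ... | yes x≡y = x≡y
    ... | no  x≢y = contradiction eq (proper right-left right-left λ { refl → x≢y refl })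

  -- Every colour lies on some edge, here oriented from left to right.
  edgeOf : ∀ k → ∃[ i ] ∃[ j ] color (left-right {i = i} {j}) ≡ k
  edgeOf k with usesAllColors k
  ... | _ , _ , left-right , eq = _ , _ , eq
  ... | _ , _ , right-left , eq = _ , _ , trans (unoriented left-right right-left) eq

  colours≤edges : t ≤ m * n
  colours≤edges = injective⇒≤ {f = λ k → combine (row k) (column k)} injective
    where
    row : Fin t → Fin m
    row k = proj₁ (edgeOf k)
    column : Fin t → Fin n
    column k = proj₁ (proj₂ (edgeOf k))
    colour : ∀ k → color (left-right {i = row k} {column k}) ≡ k
    colour k = proj₂ (proj₂ (edgeOf k))
    injective : Injective _≡_ _≡_ (λ k → combine (row k) (column k))
    injective {x} {y} eq =
      let row≡ , column≡ = combine-injective (row x) (column x) (row y) (column y) eq in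
      trans (sym (colour x))
        (trans (cong₂ (λ i j → color (left-right {i = i} {j})) row≡ column≡) (colour y))

-- In a star the number of edges and the size of the larger part are both one
-- less than the number of vertices.
star-colours : ∀ m n {t} → suc m ⊓ suc n ≡ 1 → t ∈ F (K (suc m) (suc n)) → t ≡ m + suc n
star-colours m n {t} min≡1 t∈F with ⊓-sel (suc m) (suc n)
... | inj₁ min≡m with refl ← trans (sym min≡m) min≡1 =
  ≤-antisym (subst (t ≤_) (*-identityˡ (suc n)) (colours≤edges t∈F))
            (right-size≤colours t∈F zero)
... | inj₂ min≡n with refl ← trans (sym min≡n) min≡1 =
  trans (≤-antisym (subst (t ≤_) (*-identityʳ (suc m)) (colours≤edges t∈F))
                   (left-size≤colours t∈F zero))
        (+-comm 1 m)

theorem29 : (m n : ℕ) .{{_ : NonZero m}} .{{_ : NonZero n}} →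
    (m ⊓ n ≡ 1 → (wc[ K m n ]≡ (m + n ∸ 1)) × (Wc[ K m n ]≡ (m + n ∸ 1)))
    × (2 ≤ m ⊓ n → [ m ⊔ n , m + n ] ⊆ F (K m n))
theorem29 (suc m) (suc n) = star , interval
  where
  star : suc m ⊓ suc n ≡ 1 →
         (wc[ K (suc m) (suc n) ]≡ (m + suc n)) × (Wc[ K (suc m) (suc n) ]≡ (m + suc n))
  star min≡1 = (member , λ t∈F → ≤-reflexive (sym (star-colours m n min≡1 t∈F)))
             , (member , λ t∈F → ≤-reflexive (star-colours m n min≡1 t∈F))
    where
    1+m+n≡m+1+n : suc (m + n) ≡ m + suc n
    1+m+n≡m+1+n = sym (+-suc m n)
    member : F (K (suc m) (suc n)) (m + suc n)
    member = subst (F (K (suc m) (suc n))) 1+m+n≡m+1+n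
      (sum-table∈F m n (s≤s (m≤m+n m n)) (s≤s (m≤n+m n m)) ≤-refl)

  interval : 2 ≤ suc m ⊓ suc n → [ suc m ⊔ suc n , suc m + suc n ] ⊆ F (K (suc m) (suc n))
  interval 2≤min {suc t} (max≤t , t≤m+n) with m≤n⇒m<n∨m≡n t≤m+n
  ... | inj₁ t<m+n = sum-table∈F m n
          (≤-trans (m≤m⊔n (suc m) (suc n)) max≤t) (≤-trans (m≤n⊔m (suc m) (suc n)) max≤t)
          (≤-trans (≤-pred t<m+n) (≤-reflexive (+-suc m n)))
  ... | inj₂ refl
    with s≤s (s≤s _) ← ≤-trans 2≤min (m⊓n≤m (suc m) (suc n))
       | s≤s (s≤s _) ← ≤-trans 2≤min (m⊓n≤n (suc m) (suc n)) = m+n∈F _ _
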